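{- Let $\mathcal{G}$ be a directed mixed graph (DMG) with nodes $\mathcal{V}^+=\mathcal{V}\cup\mathcal{S}$ (with $\mathcal V$ and $\mathcal S$ disjoint), and let $\mathcal{H}$ be a $\sigma$-MAG with nodes $\mathcal V$ that represents $\mathcal{G}$ given $\mathcal{S}$. Let $X,Y,Z\subseteq\mathcal{V}$ be subsets of the nodes. Then $X$ is $m$-separated from $Y$ given $Z$ in $\mathcal{H}$ if and only if $X$ is $\sigma$-separated from $Y$ given $Z\cup\mathcal{S}$ in $\mathcal{G}$.
   Context: **Mixed graphs.** A mixed graph $\mathcal{H}=(\mathcal{V},\mathcal{E})$ has nodes $\mathcal{V}$ and edges between nodes of the types $\rightarrow,\leftarrow,\leftrightarrow,-$ ($a\rightarrow b$ is the same as $b\leftarrow a$; $\leftrightarrow$ and $-$ are symmetric). Each edge has a mark (tail or arrowhead) at each end; $*$ stands for either mark: $a\mathrel{*\!\!\rightarrow} b$ (equivalently $b\mathrel{\leftarrow\!\!*}a$) means $a\rightarrow b$ or $a\leftrightarrow b$ (the edge is into $b$); $a\mathrel{ -\!\!*}b$ means $a\rightarrow b$ or $a-b$ (the edge is out of $a$). Two nodes are adjacent if there is an edge between them. A walk between $v_0$ and $v_n$ ($n\ge 0$) is an alternating sequence $v_0,e_1,v_1,\dots,e_n,v_n$ with $e_i$ an edge between $v_{i-1}$ and $v_i$; it is a path if no node occurs more than once. It is a directed walk (path) from $v_0$ to $v_n$ if $e_i$ is $v_{i-1}\rightarrow v_i$ for all $i$, and an anterior walk (path) from $v_0$ to $v_n$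 if $e_i$ is $v_{i-1}\mathrel{ -\!\!*}v_i$ for all $i$. $\mathrm{Anc}_{\mathcal H}(b)$ is the set of nodes from which there is a directed walk to $b$ (so $b\in\mathrm{Anc}_{\mathcal H}(b)$), and $\mathrm{Anc}_{\mathcal H}(A)=\bigcup_{v\in A}\mathrm{Anc}_{\mathcal H}(v)$. A non-endpoint $v_k$ of a walk is a collider on it if both adjacent edges on the walk have an arrowhead at $v_k$; all other nodes on the walk, including endpoints, are non-colliders. An inducing path is a path between $v_0$ and $v_n$ on which every non-endpoint node is a collider and belongs to $\mathrm{Anc}_{\mathcal H}(\{v_0,v_n\})$. **$\sigma$-MAG.** A mixed graph $\mathcal H$ is a $\sigma$-MAG if: (1) between any two distinct nodes there is at most one edge, and no node is adjacent to itself; (2) (ancestral) if $\mathcal H$ contains an anterior path from $a$ to $b$, then it contains no edge $a\mathrel{\leftarrow\!\!*}b$; (3a) (maximal) there is no inducing path between any two distinct non-adjacent nodes; (3b) ($\sigma$-complete) if $\mathcal H$ contains $a\mathrel{*\!\!\rightarrow}b$ and $b-c$, then $a$ and $c$ are adjacent; and if moreover $\mathcal H$ contains $b-d$ with $d\ne c$, then $c$ and $d$ are adjacent. **$m$-separation.** A walk (or path) $v_0,\dots,v_n$ ($n\ge0$) in a $\sigma$-MAG $\mathcal H$ is $Z$-$m$-open if (a) no non-collider on it (endpoints included) is in $Z$, (b) all colliders on it are in $\mathrm{Anc}_{\mathcal H}(Z)$, and (c) it contains no subwalk of the form $v_{k-1}\mathrel{*\!\!\rightarrow}v_k-v_{k+1}$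 or $v_{k-1}-v_k\mathrel{\leftarrow\!\!*}v_{k+1}$; otherwise it is $m$-blocked by $Z$. $X$ is $m$-separated from $Y$ given $Z$ in $\mathcal H$ if every walk in $\mathcal H$ from a node in $X$ to a node in $Y$ is $m$-blocked by $Z$. **DMGs.** A DMG $\mathcal G$ has a node set, directed edges $u\rightarrow v$ and bidirected (symmetric) edges $u\leftrightarrow v$ between distinct nodes; at most one edge of each of the types $u\rightarrow v$, $v\rightarrow u$, $u\leftrightarrow v$ between each pair (several types may coexist), no self-loops. Walks, paths, $\mathrm{Anc}_{\mathcal G}$, colliders and non-colliders are defined as for mixed graphs. $\mathrm{Sc}_{\mathcal G}(v)$ is the strongly connected component of $v$: all $w$ with $w\in\mathrm{Anc}_{\mathcal G}(v)$ and $v\in\mathrm{Anc}_{\mathcal G}(w)$. A non-collider $v_k$ on a walk is unblockable if it is not an endpoint and every directed edge on the walk going out of $v_k$ to a neighbouring node $v_{k\pm1}$ on the walk satisfies $v_{k\pm1}\in\mathrm{Sc}_{\mathcal G}(v_k)$; otherwise (in particular if it is an endpoint) it is blockable. For distinct $v_i,v_j\in\mathcal V$, a path (walk) in $\mathcal G$ between $v_i$ and $v_j$ is $\sigma$-inducing given $\mathcal S$ if each collider on it is in $\mathrm{Anc}_{\mathcal G}(\{v_i,v_j\}\cup\mathcal S)$ and each non-endpoint non-collider on it is unblockable. **$\sigma$-separation.** For a set $W$ of nodes of a DMG $\mathcal G$, a walk in $\mathcal G$ is $W$-$\sigma$-open if all colliders on it are in $\mathrm{Anc}_{\mathcal G}(W)$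 and no blockable non-collider on it is in $W$; otherwise it is $W$-$\sigma$-blocked. $X$ is $\sigma$-separated from $Y$ given $W$ in $\mathcal G$ if every walk from a node in $X$ to a node in $Y$ is $W$-$\sigma$-blocked. **Representation.** Let $\mathcal G$ be a DMG with nodes $\mathcal V\cup\mathcal S$. The mixed graph $\mathcal H$ with nodes $\mathcal V$ represents $\mathcal G$ given $\mathcal S$ if: (1) in $\mathcal H$ there is at most one edge between any two distinct nodes and no edge from a node to itself; (2) distinct $a,b\in\mathcal V$ are adjacent in $\mathcal H$ if and only if there is a $\sigma$-inducing path between $a$ and $b$ given $\mathcal S$ in $\mathcal G$; (3) if $a\mathrel{\leftarrow\!\!*}b$ in $\mathcal H$ then $a\notin\mathrm{Anc}_{\mathcal G}(\{b\}\cup\mathcal S)$; (4) if $a\mathrel{ -\!\!*}b$ in $\mathcal H$ then $a\in\mathrm{Anc}_{\mathcal G}(\{b\}\cup\mathcal S)$. -}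

module Defs where

open import Data.List using (List; []; _∷_)
open import Data.List.Relation.Unary.Unique.Propositional using (Unique)
open import Data.Product using (∃; ∃₂; ∃-syntax; _×_)
open import Data.Sum using (_⊎_; inj₁; inj₂)
open import Function.Bundles using (_⇔_)
open import Relation.Binary.Construct.Closure.ReflexiveTransitive using (Star; ε; _◅_)
open import Relation.Binary.Core using (Rel)
open import Relation.Binary.PropositionalEquality using (_≡_; _≢_)
open import Relation.Nullary using (¬_)
open import Relation.Unary using (Pred; _∈_; _∉_; _⊆_; _∪_; ∅; U; ｛_｝; _⟨⊎⟩_)
open import Level using (0ℓ)

Subset : Set → Set₁
Subset A = Pred A 0ℓ

data Mark : Set where
  tail arrow : Mark

-- Edge a m m′ b says that there is an edge between a and b with mark m at a
-- and mark m′ at b.  The edges form a relation, i.e. a subset of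
-- N × Mark × Mark × N, so there is at most one edge of each type between two
-- nodes; no definition below distinguishes inhabitants of Edge a m m′ b.
record MixedGraph (N : Set) : Set₁ where
  field
    Edge : N → Mark → Mark → N → Set
    flip : ∀ {a m m′ b} → Edge a m m′ b → Edge b m′ m a

  infix 4 _⟶_ _⟷_ _—_ _*→_ _←*_ _-*_

  _⟶_ _⟷_ _—_ _*→_ _←*_ _-*_ : Rel N 0ℓ
  a ⟶ b  = Edge a tail arrow b
  a ⟷ b  = Edge a arrow arrow b
  a — b   = Edge a tail tail b
  a *→ b  = a ⟶ b ⊎ a ⟷ b
  a ←* b  = b *→ a
  a -* b  = a ⟶ b ⊎ a — b

  Adjacent : Rel N 0ℓ
  Adjacent a b = ∃₂ λ m m′ → Edge a m m′ b

-- An edge as traversed by a walk from a to b.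
record Link {N : Set} (G : MixedGraph N) (a b : N) : Set where
  constructor link
  field
    markˡ markʳ : Mark
    edge        : MixedGraph.Edge G a markˡ markʳ b

open Link public

module _ {N : Set} {R : Rel N 0ℓ} where

  nodes : ∀ {a b} → Star R a b → List N
  nodes {a} ε       = a ∷ []
  nodes {a} (e ◅ w) = a ∷ nodes w

  IsPath : ∀ {a b} → Star R a b → Set
  IsPath w = Unique (nodes w)

  -- An inhabitant of Consecutive w e f is a non-endpoint position on w, with
  -- e and f the steps just before and just after it.
  data Consecutive : ∀ {a b u v x} → Star R a b → R u v → R v x → Set where
    here  : ∀ {u v x b} {e : R u v} {f : R v x} {w : Star R x b} →
            Consecutive (e ◅ f ◅ w) e f
    there : ∀ {a c b u v x} {d : R a c} {w : Star R c b} {e : R u v} {f : R v x} →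
            Consecutive w e f → Consecutive (d ◅ w) e f

module _ {N : Set} (G : MixedGraph N) where
  open MixedGraph G

  Walk : Rel N 0ℓ
  Walk = Star (Link G)

  DirectedWalk : Rel N 0ℓ
  DirectedWalk = Star _⟶_

  AnteriorWalk : Rel N 0ℓ
  AnteriorWalk = Star _-*_

  AnteriorPath : Rel N 0ℓ
  AnteriorPath a b = ∃ λ (w : AnteriorWalk a b) → IsPath w

  Anc : Subset N → Subset N
  Anc A a = ∃[ b ] (b ∈ A × DirectedWalk a b)

  Sc : N → Subset N
  Sc v w = w ∈ Anc ｛ v ｝ × v ∈ Anc ｛ w ｝

  Collides : ∀ {u v x} → Link G u v → Link G v x → Set
  Collides e f = markʳ e ≡ arrow × markˡ f ≡ arrow

  data Collider {a b} (w : Walk a b) : Subset N where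
    collider : ∀ {u v x} {e : Link G u v} {f : Link G v x} →
               Consecutive w e f → Collides e f → Collider w v

  -- NonCollider w v says that v occurs on w at some position as a non-collider;
  -- v may occur elsewhere on w as a collider.
  data NonCollider {a b} (w : Walk a b) : Subset N where
    first    : NonCollider w a
    last     : NonCollider w b
    interior : ∀ {u v x} {e : Link G u v} {f : Link G v x} →
               Consecutive w e f → ¬ Collides e f → NonCollider w v

  OutgoingInSc : ∀ {u v x} → Link G u v → Link G v x → Set
  OutgoingInSc {u} {v} {x} e f =
    (markʳ e ≡ tail × markˡ e ≡ arrow → u ∈ Sc v) ×
    (markˡ f ≡ tail × markʳ f ≡ arrow → x ∈ Sc v)

  data BlockableNonCollider {a b} (w : Walk a b) : Subset N where
    first    : BlockableNonCollider w a
    last     : BlockableNonCollider w b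
    interior : ∀ {u v x} {e : Link G u v} {f : Link G v x} →
               Consecutive w e f → ¬ Collides e f → ¬ OutgoingInSc e f →
               BlockableNonCollider w v

  record Inducing {a b} (w : Walk a b) : Set where
    field
      isPath    : IsPath w
      colliders : ∀ {u v x} {e : Link G u v} {f : Link G v x} →
                  Consecutive w e f →
                  Collides e f × v ∈ Anc (｛ a ｝ ∪ ｛ b ｝)

  record SigmaInducingPath (S : Subset N) {a b} (w : Walk a b) : Set where
    field
      isPath      : IsPath w
      colliders   : Collider w ⊆ Anc (｛ a ｝ ∪ ｛ b ｝ ∪ S)
      unblockable : ∀ {u v x} {e : Link G u v} {f : Link G v x} →
                    Consecutive w e f → ¬ Collides e f → OutgoingInSc e f

  record Simple : Set where
    field
      atMostOne : ∀ {a b m m′ k k′} → a ≢ b →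
                  Edge a m m′ b → Edge a k k′ b → m ≡ k × m′ ≡ k′
      loopless  : ∀ {a} → ¬ Adjacent a a

  record IsSigmaMAG : Set where
    field
      simple         : Simple
      ancestral      : ∀ {a b} → AnteriorPath a b → ¬ (a ←* b)
      maximal        : ∀ {a b} → a ≢ b → ¬ Adjacent a b →
                       (w : Walk a b) → ¬ Inducing w
      sigmaComplete₁ : ∀ {a b c} → a *→ b → b — c → Adjacent a c
      sigmaComplete₂ : ∀ {a b c d} → a *→ b → b — c → b — d → d ≢ c →
                       Adjacent c d

  record IsDMG : Set where
    field
      noUndirected : ∀ {a b} → ¬ (a — b)
      loopless     : ∀ {a} → ¬ Adjacent a a

  record MOpen (Z : Subset N) {a b} (w : Walk a b) : Set where
    field
      nonColliders : ∀ {v} → NonCollider w v → v ∉ Z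
      colliders    : Collider w ⊆ Anc Z
      noIntoLine   : ∀ {u v x} {e : Link G u v} {f : Link G v x} →
                     Consecutive w e f →
                     ¬ (markʳ e ≡ arrow × markˡ f ≡ tail × markʳ f ≡ tail)
      noLineInto   : ∀ {u v x} {e : Link G u v} {f : Link G v x} →
                     Consecutive w e f →
                     ¬ (markˡ e ≡ tail × markʳ e ≡ tail × markˡ f ≡ arrow)

  MBlocked : Subset N → ∀ {a b} → Walk a b → Set
  MBlocked Z w = ¬ MOpen Z w

  MSeparated : Subset N → Subset N → Subset N → Set
  MSeparated X Y Z = ∀ {x y} → x ∈ X → y ∈ Y → (w : Walk x y) → MBlocked Z w

  record SigmaOpen (W : Subset N) {a b} (w : Walk a b) : Set where
    field
      colliders    : Collider w ⊆ Anc W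
      nonColliders : ∀ {v} → BlockableNonCollider w v → v ∉ W

  SigmaBlocked : Subset N → ∀ {a b} → Walk a b → Set
  SigmaBlocked W w = ¬ SigmaOpen W w

  SigmaSeparated : Subset N → Subset N → Subset N → Set
  SigmaSeparated X Y W =
    ∀ {x y} → x ∈ X → y ∈ Y → (w : Walk x y) → SigmaBlocked W w

-- The disjoint union 𝒱 ∪ 𝒮 is the type V ⊎ S.  A subset of 𝒱 is carried into it
-- by observed, and 𝒮 itself, as a set of nodes of V ⊎ S, is selected.
module _ {V S : Set} where

  observed : Subset V → Subset (V ⊎ S)
  observed A = A ⟨⊎⟩ ∅

  selected : Subset (V ⊎ S)
  selected = ∅ ⟨⊎⟩ U

record Represents {V S : Set} (H : MixedGraph V) (G : MixedGraph (V ⊎ S)) : Set where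
  open MixedGraph H
  field
    simple    : Simple H
    adjacency : ∀ {a b} → a ≢ b →
                Adjacent a b ⇔
                (∃ λ (w : Walk G (inj₁ a) (inj₁ b)) → SigmaInducingPath G selected w)
    arrowhead : ∀ {a b} → a ←* b → inj₁ a ∉ Anc G (｛ inj₁ b ｝ ∪ selected)
    tailmark  : ∀ {a b} → a -* b → inj₁ a ∈ Anc G (｛ inj₁ b ｝ ∪ selected)

{-# OPTIONS --safe #-}
module Submission where

open import Defs
open import Data.Empty using (⊥-elim)
open import Data.List.Relation.Unary.All as All using (All; []; _∷_)
open import Data.List.Relation.Unary.All.Properties using (¬Any⇒All¬)
open import Data.List.Relation.Unary.Any using (here; there)
open import Data.List.Membership.Propositional as List using ()
open import Data.List.Relation.Unary.AllPairs using ([]; _∷_)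
open import Data.Product using (∃; ∃₂; _×_; _,_; proj₁; proj₂)
open import Data.Sum using (_⊎_; inj₁; inj₂; [_,_]′)
open import Data.Unit using (⊤; tt)
open import Effect.Monad using (RawMonad)
open import Function.Base using (_∘_; id)
open import Function.Bundles using (_⇔_; mk⇔; Equivalence)
open import Level using (0ℓ)
open import Relation.Binary.Construct.Closure.ReflexiveTransitive using (ε; _◅_; _◅◅_)
open import Relation.Binary.Core using (Rel)
open import Relation.Binary.PropositionalEquality using (_≡_; _≢_; refl)
open import Relation.Nullary using (¬_; Dec; yes; no; contradiction)
open import Relation.Nullary.Decidable using (¬¬-excluded-middle)
open import Relation.Nullary.Negation using (¬¬-Monad; ¬¬-map)
open import Relation.Unary using (_∈_; _∉_; _⊆_; _∪_; ｛_｝)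

open RawMonad (¬¬-Monad {0ℓ}) using (_>>=_; pure)

-- Both directions turn an open walk in one graph into one in the other, up to double negation,
-- which suffices since separation is a negative statement and makes classical case distinctions
-- available.  Write a ≼ b for a ∈ Anc ({b} ∪ S) in G; this preorder determines all marks of H.
--
-- From H to G, replace the edges by σ-inducing paths.  A path whose edge has an arrowhead at b
-- either is into b or leaves b within its strongly connected component, so colliders of H cause
-- no blocking in G.  Colliders of the composed walk may be ancestors of its endpoints only;
-- there the walk is shortcut by a directed walk.
--
-- From G to H, let all colliders be in Z or Anc S, by excursions to Z and back, and cut the walk
-- at its blockable non-colliders and its colliders in Z.  The pieces are σ-inducing walks, hence
-- give edges of H.  A blockable non-collider outside Anc S is strictly below one of its
-- neighbours, so that it is a non-collider in H not on an undirected edge met by an arrowhead.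
-- A cut at a node of Z below one of its neighbours is undone: the two pieces together are again
-- σ-inducing, and strictness at the neighbours persists.  The remaining cuts in Z are colliders.

-- Predicates on the ends and interior positions of walks.

module _ {N : Set} {G : MixedGraph N} where

  AtFirst : ∀ {a b} → (∀ {x} → Link G a x → Set) → Walk G a b → Set
  AtFirst P ε       = ⊤
  AtFirst P (e ◅ w) = P e

  AtLast : ∀ {a b} → (∀ {u} → Link G u b → Set) → Walk G a b → Set
  AtLast P ε           = ⊤
  AtLast P (e ◅ ε)     = P e
  AtLast P (e ◅ f ◅ w) = AtLast P (f ◅ w)

  data Interior (P : ∀ {u v x} → Link G u v → Link G v x → Set) :
                ∀ {a b} → Walk G a b → Set where
    ε   : ∀ {a} → Interior P (ε {x = a})
    [-] : ∀ {a b} {e : Link G a b} → Interior P (e ◅ ε)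
    _∷_ : ∀ {a b c d} {e : Link G a b} {f : Link G b c} {w : Walk G c d} →
          P e f → Interior P (f ◅ w) → Interior P (e ◅ f ◅ w)

  atFirst-map : ∀ {a b} {P Q : ∀ {x} → Link G a x → Set} →
                (∀ {x} (e : Link G a x) → P e → Q e) →
                (w : Walk G a b) → AtFirst P w → AtFirst Q w
  atFirst-map g ε       p = tt
  atFirst-map g (e ◅ w) p = g e p

  atLast-map : ∀ {a b} {P Q : ∀ {u} → Link G u b → Set} →
               (∀ {u} (e : Link G u b) → P e → Q e) →
               (w : Walk G a b) → AtLast P w → AtLast Q w
  atLast-map g ε           p = tt
  atLast-map g (e ◅ ε)     p = g e p
  atLast-map g (e ◅ f ◅ w) p = atLast-map g (f ◅ w) p

  atLast-elim : ∀ {a b c} {C : Set} {P Q : ∀ {u} → Link G u c → Set} {f : Link G a b} →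
                (∀ {u} (e : Link G u c) → P e → Q e → C) →
                (w : Walk G b c) → AtLast P (f ◅ w) → AtLast Q (f ◅ w) → C
  atLast-elim g ε       p q = g _ p q
  atLast-elim g (e ◅ w) p q = atLast-elim g w p q

  atFirst-tabulate : ∀ {a b} {P : ∀ {x} → Link G a x → Set} →
                     (∀ {x} (e : Link G a x) → P e) → (w : Walk G a b) → AtFirst P w
  atFirst-tabulate g ε       = tt
  atFirst-tabulate g (e ◅ w) = g e

  atFirst-◅◅-≢ : ∀ {a b c} {P : ∀ {x} → Link G a x → Set} → a ≢ b →
                 (w : Walk G a b) {w′ : Walk G b c} → AtFirst P w → AtFirst P (w ◅◅ w′)
  atFirst-◅◅-≢ a≢b ε       p = contradiction refl a≢b
  atFirst-◅◅-≢ a≢b (e ◅ w) p = p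

  atLast-tabulate : ∀ {a b} {P : ∀ {u} → Link G u b → Set} →
                    (∀ {u} (e : Link G u b) → P e) → (w : Walk G a b) → AtLast P w
  atLast-tabulate g ε           = tt
  atLast-tabulate g (e ◅ ε)     = g e
  atLast-tabulate g (e ◅ f ◅ w) = atLast-tabulate g (f ◅ w)

  module _ {P : ∀ {u v} → Link G u v → Set} where

    atFirst-◅◅ : ∀ {a b c} (w : Walk G a b) {w′ : Walk G b c} →
                 AtFirst P w → AtFirst P w′ → AtFirst P (w ◅◅ w′)
    atFirst-◅◅ ε       p q = q
    atFirst-◅◅ (e ◅ w) p q = p

    atLast-◅◅ : ∀ {a b c} (w : Walk G a b) (w′ : Walk G b c) →
                AtLast P w → AtLast P w′ → AtLast P (w ◅◅ w′)
    atLast-◅◅ ε           w′       p q = q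
    atLast-◅◅ (e ◅ ε)     ε        p q = p
    atLast-◅◅ (e ◅ ε)     (f ◅ w′) p q = q
    atLast-◅◅ (e ◅ f ◅ w) w′       p q = atLast-◅◅ (f ◅ w) w′ p q

  nodes-◅◅ : ∀ {Q : Subset N} {a b c} (w : Walk G a b) (w′ : Walk G b c) →
             All Q (nodes w) → All Q (nodes w′) → All Q (nodes (w ◅◅ w′))
  nodes-◅◅ ε       w′ p       q = q
  nodes-◅◅ (e ◅ w) w′ (p ∷ ps) q = p ∷ nodes-◅◅ w w′ ps q

  module _ {P : ∀ {u v x} → Link G u v → Link G v x → Set} where

    tabulate : ∀ {a b} (w : Walk G a b) →
               (∀ {u v x} {e : Link G u v} {f : Link G v x} → Consecutive w e f → P e f) →
               Interior P w
    tabulate ε           h = ε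
    tabulate (e ◅ ε)     h = [-]
    tabulate (e ◅ f ◅ w) h = h here ∷ tabulate (f ◅ w) (h ∘ there)

    lookup : ∀ {a b} {w : Walk G a b} → Interior P w →
             ∀ {u v x} {e : Link G u v} {f : Link G v x} → Consecutive w e f → P e f
    lookup (p ∷ i) here      = p
    lookup (p ∷ i) (there c) = lookup i c

    cons : ∀ {a b c} {e : Link G a b} (w : Walk G b c) →
           AtFirst (P e) w → Interior P w → Interior P (e ◅ w)
    cons ε       p i = [-]
    cons (f ◅ w) p i = p ∷ i

    uncons : ∀ {a b c} {e : Link G a b} (w : Walk G b c) →
             Interior P (e ◅ w) → Interior P w
    uncons ε       [-]     = ε
    uncons (f ◅ w) (p ∷ i) = i

    interior-◅◅ : ∀ {a b c} (w : Walk G a b) {w′ : Walk G b c} →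
                  Interior P w → Interior P w′ →
                  AtLast (λ e → AtFirst (P e) w′) w → Interior P (w ◅◅ w′)
    interior-◅◅ ε           i       j q = j
    interior-◅◅ (e ◅ ε)     i       j q = cons _ q j
    interior-◅◅ (e ◅ f ◅ w) (p ∷ i) j q = p ∷ interior-◅◅ (f ◅ w) i j q

  interior-map : ∀ {P Q : ∀ {u v x} → Link G u v → Link G v x → Set} →
                 (∀ {u v x} {e : Link G u v} {f : Link G v x} → P e f → Q e f) →
                 ∀ {a b} {w : Walk G a b} → Interior P w → Interior Q w
  interior-map g ε       = ε
  interior-map g [-]     = [-]
  interior-map g (p ∷ i) = g p ∷ interior-map g i

  consecutive-∈ : ∀ {a b} {w : Walk G a b} {u v x} {e : Link G u v} {f : Link G v x} →
                  Consecutive w e f → v List.∈ nodes w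
  consecutive-∈ {w = e ◅ f ◅ ε}     here      = there (here refl)
  consecutive-∈ {w = e ◅ f ◅ _ ◅ _} here      = there (here refl)
  consecutive-∈                     (there c) = there (consecutive-∈ c)

  collides? : ∀ {u v x} (e : Link G u v) (f : Link G v x) → Dec (Collides G e f)
  collides? (link _ tail _)  f                = no λ { (() , _) }
  collides? (link _ arrow _) (link tail _ _)  = no λ { (_ , ()) }
  collides? (link _ arrow _) (link arrow _ _) = yes (refl , refl)

-- Removing colliders outside the ancestors of `W`.

module Opening {N : Set} (G : MixedGraph N) (W : Subset N) where
  open MixedGraph G

  -- The set allowed for colliders is a parameter because it shrinks from `AncestorOfEnds` to
  -- `Anc G W`. At a collider the second condition is vacuous, as neither half-edge there is a tail.
  LocallyOpen : Subset N → ∀ {u v x} → Link G u v → Link G v x → Set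
  LocallyOpen A {v = v} e f = (Collides G e f → v ∈ A) × (v ∈ W → OutgoingInSc G e f)

  anc-∌ : ∀ {a b} → a ⟶ b → a ∉ Anc G W → b ∉ Anc G W
  anc-∌ s a∉ (c , c∈W , d) = a∉ (c , c∈W , s ◅ d)

  ∌-anc : ∀ {a} → a ∉ Anc G W → a ∉ W
  ∌-anc a∉ a∈W = a∉ (_ , a∈W , ε)

  locally-open-tail : ∀ {A u v x} (e : Link G u v) (f : Link G v x) →
                      v ∉ W → markˡ f ≡ tail → LocallyOpen A e f
  locally-open-tail e (link tail _ _) v∉ refl = (λ { (_ , ()) }) , λ v∈ → contradiction v∈ v∉

  -- A node of `W` on the way would put `v` into `Anc G W`, and each interior node has its outgoing
  -- edge on the walk, so it is no collider.
  descend : ∀ {v y} → DirectedWalk G v y → v ∉ Anc G W →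
            ∃ λ (w : Walk G v y) → Interior (LocallyOpen (Anc G W)) w × AtFirst (λ f → markˡ f ≡ tail) w
  descend ε       v∉ = ε , ε , tt
  descend (s ◅ d) v∉ =
    let e           = link tail arrow s
        (w , i , t) = descend d (anc-∌ s v∉)
        open-at     = λ {x} (f : Link G _ x) → locally-open-tail {A = Anc G W} e f (∌-anc (anc-∌ s v∉))
    in e ◅ w , cons w (atFirst-map open-at w t) i , refl

  ascend : ∀ {v n x y} {f : Link G v n} {w : Walk G n y} → DirectedWalk G v x → v ∉ Anc G W →
           Interior (LocallyOpen (Anc G W)) (f ◅ w) →
           ∃ λ (w′ : Walk G x y) → Interior (LocallyOpen (Anc G W)) w′
  ascend ε       v∉ i = _ , i
  ascend (s ◅ d) v∉ i =
    ascend {f = link arrow tail (flip s)} d (anc-∌ s v∉)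
      (((λ { (() , _) }) , λ ∈W → contradiction ∈W (∌-anc v∉)) ∷ i)

  module _ {x y : N} where

    AncestorOfEnds : Subset N
    AncestorOfEnds v = v ∈ Anc G W ⊎ DirectedWalk G v x ⊎ DirectedWalk G v y

    -- A collider outside Anc W with a directed walk to an endpoint allows a shortcut along that
    -- walk, on which there are no colliders and no nodes of W.
    shortcut : ∀ {n m} (f : Link G n m) (w : Walk G m y) →
               Interior (LocallyOpen AncestorOfEnds) (f ◅ w) →
               ¬ ¬ ((∃ λ (w′ : Walk G m y) → Interior (LocallyOpen (Anc G W)) (f ◅ w′)) ⊎
                    (∃ λ (w′ : Walk G x y) → Interior (LocallyOpen (Anc G W)) w′))
    shortcut f ε i = pure (inj₁ (ε , [-]))
    shortcut {m = m} f (g ◅ w) ((c , o) ∷ i) = do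
      no m∉ ← ¬¬-excluded-middle {A = Collides G f g → m ∈ Anc G W}
        where yes m∈ → do
                inj₁ (w′ , i′) ← shortcut g w i
                  where inj₂ r → pure (inj₂ r)
                pure (inj₁ (g ◅ w′ , (m∈ , o) ∷ i′))
      yes col ← pure (collides? f g)
        where no ¬col → contradiction (λ col → contradiction col ¬col) m∉
      inj₂ (inj₁ d) ← pure (c col)
        where
          inj₁ m∈ → contradiction (λ _ → m∈) m∉
          inj₂ (inj₂ d) →
            let (w′ , i′ , t) = descend d (λ m∈ → m∉ λ _ → m∈)
            in pure (inj₁ (w′ , cons w′
                 (atFirst-map (λ g → locally-open-tail {A = Anc G W} f g (∌-anc λ m∈ → m∉ λ _ → m∈)) w′ t) i′))
      -- Here the directed walk leads to `x`: the part up to `m` is discarded, and the repaired rest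
      -- is reached from `x` by that walk in reverse.
      inj₁ (w′ , i′) ← shortcut g w i
        where inj₂ r → pure (inj₂ r)
      pure (inj₂ (ascend {f = g} d (λ m∈ → m∉ λ _ → m∈) i′))

    make-open : (w : Walk G x y) → Interior (LocallyOpen AncestorOfEnds) w →
                ¬ ¬ ∃ λ (w′ : Walk G x y) → Interior (LocallyOpen (Anc G W)) w′
    make-open ε       i = pure (ε , ε)
    make-open (f ◅ w) i = ¬¬-map [ (λ (w′ , i′) → f ◅ w′ , i′) , id ]′ (shortcut f w i)

-- The ancestral preorder relative to `S`.

module SelectedDMG {N : Set} (G : MixedGraph N) (dmg : IsDMG G) (S : Subset N) where
  open MixedGraph G
  open IsDMG dmg using (noUndirected)

  infix 4 _≼_ _≺_

  _≼_ : Rel N 0ℓ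
  a ≼ b = a ∈ Anc G (｛ b ｝ ∪ S)

  anc-step : ∀ {A a b} → a ⟶ b → b ∈ Anc G A → a ∈ Anc G A
  anc-step s (c , c∈A , d) = c , c∈A , s ◅ d

  anc-walk : ∀ {A a b} → DirectedWalk G a b → b ∈ Anc G A → a ∈ Anc G A
  anc-walk d (c , c∈A , d′) = c , c∈A , d ◅◅ d′

  ≼-refl : ∀ {a} → a ≼ a
  ≼-refl = _ , inj₁ refl , ε

  selected⇒≼ : ∀ {a b} → a ∈ Anc G S → a ≼ b
  selected⇒≼ (c , c∈S , d) = c , inj₂ c∈S , d

  ≼-split : ∀ {a b} → a ≼ b → DirectedWalk G a b ⊎ a ∈ Anc G S
  ≼-split (_ , inj₁ refl , d) = inj₁ d
  ≼-split (_ , inj₂ c∈S , d)  = inj₂ (_ , c∈S , d)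

  ≼-trans : ∀ {a b c} → a ≼ b → b ≼ c → a ≼ c
  ≼-trans p q with ≼-split p
  ... | inj₁ d = anc-walk d q
  ... | inj₂ s = selected⇒≼ s

  ≼-anc : ∀ {A a b} → S ⊆ A → a ≼ b → b ∈ Anc G A → a ∈ Anc G A
  ≼-anc S⊆A p q with ≼-split p
  ... | inj₁ d              = anc-walk d q
  ... | inj₂ (c , c∈S , d) = c , S⊆A c∈S , d

  -- Nodes of Anc S lie below every node, so strictness is only required of the others.
  _≺_ : Rel N 0ℓ
  a ≺ b = a ≼ b × (b ≼ a → a ∈ Anc G S)

  selected⇒≺ : ∀ {a b} → a ∈ Anc G S → a ≺ b
  selected⇒≺ s = selected⇒≼ s , λ _ → s

  ≺-irrefl : ∀ {a} → a ≺ a → a ∈ Anc G S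
  ≺-irrefl (_ , p) = p ≼-refl

  ≺-≼-trans : ∀ {a b c} → a ≺ b → b ≼ c → a ≺ c
  ≺-≼-trans (p , q) r = ≼-trans p r , λ c≼a → q (≼-trans r c≼a)

  -- Membership in `Anc` of `a`, `b` and `S`, as σ-inducing walks require of colliders, split so
  -- that each case moves along `≼`.
  Between : N → N → Subset N
  Between a b n = n ≼ a ⊎ n ≼ b

  -- A half-edge at v is safe if v is not blockable on account of it.
  SafeAtLeft : ∀ {v x} → Link G v x → Set
  SafeAtLeft {v} {x} f = markˡ f ≡ tail × markʳ f ≡ arrow → x ∈ Sc G v

  SafeAtRight : ∀ {u v} → Link G u v → Set
  SafeAtRight {u} {v} e = markʳ e ≡ tail × markˡ e ≡ arrow → u ∈ Sc G v

  ≼-back⇒Sc : ∀ {v x} → v ⟶ x → x ≼ v → x ∈ Sc G v ⊎ v ∈ Anc G S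
  ≼-back⇒Sc s p with ≼-split p
  ... | inj₁ d = inj₁ ((_ , refl , d) , (_ , refl , s ◅ ε))
  ... | inj₂ q = inj₂ (anc-step s q)

  -- What the half-edges at the ends of a walk say about the preorder.

  CollidersIn : Subset N → ∀ {u v x} → Link G u v → Link G v x → Set
  CollidersIn B {v = v} e f = Collides G e f → v ∈ B

  -- Every non-collider on a walk has a directed edge out of it, so following the walk leads
  -- from it to a collider or to an endpoint: the colliders and endpoints control all nodes.
  module Following (B : Subset N) (closed : ∀ {a b} → a ⟶ b → b ∈ B → a ∈ B) where

    first-out : ∀ {n x b} {f : Link G n x} {w : Walk G x b} → b ∈ B →
                Interior (CollidersIn B) (f ◅ w) → markˡ f ≡ tail → x ∈ B
    first-out {f = link tail tail s} b∈B i refl = ⊥-elim (noUndirected s)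
    first-out {f = link tail arrow s} {ε} b∈B i refl = b∈B
    first-out {f = link tail arrow s} {link arrow _ t ◅ w} b∈B (c ∷ i) refl = c (refl , refl)
    first-out {f = link tail arrow s} {link tail tail t ◅ w} b∈B (c ∷ i) refl = ⊥-elim (noUndirected t)
    first-out {f = link tail arrow s} {link tail arrow t ◅ w} b∈B (c ∷ i) refl = closed t (first-out b∈B i refl)

    -- The mirror image of `first-out`, run from left to right. The hypothesis on `n` is the
    -- invariant: after an arrowhead at `x` the collider condition restores it, after a tail closure
    -- does.
    last-out : ∀ {n x b} {f : Link G n x} {w : Walk G x b} → (markˡ f ≡ arrow → n ∈ B) →
               Interior (CollidersIn B) (f ◅ w) →
               AtLast (λ {u} e → markʳ e ≡ tail → u ∈ B) (f ◅ w)
    last-out {f = link tail tail s} h [-] refl = ⊥-elim (noUndirected s)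
    last-out {f = link arrow tail s} h [-] refl = h refl
    last-out {f = link _ arrow s} h (c ∷ i) = last-out (λ p → c (refl , p)) i
    last-out {f = link tail tail s} h (c ∷ i) = ⊥-elim (noUndirected s)
    last-out {f = link arrow tail s} h (c ∷ i) = last-out (λ _ → closed (flip s) (h refl)) i

    middle-in : ∀ {u v x b} {e : Link G u v} {f : Link G v x} {w : Walk G x b} → u ∈ B → b ∈ B →
                Interior (CollidersIn B) (e ◅ f ◅ w) → v ∈ B
    middle-in {f = link tail tail t} u∈B b∈B i = ⊥-elim (noUndirected t)
    middle-in {f = link tail arrow t} u∈B b∈B (c ∷ i) = closed t (first-out b∈B i refl)
    middle-in {e = link _ arrow s} {link arrow _ t} u∈B b∈B (c ∷ i) = c (refl , refl)
    middle-in {e = link tail tail s} {link arrow _ t} u∈B b∈B i = ⊥-elim (noUndirected s)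
    middle-in {e = link arrow tail s} {link arrow _ t} u∈B b∈B i = closed (flip s) u∈B

    nodes-in : ∀ {a b} {w : Walk G a b} → a ∈ B → b ∈ B → Interior (CollidersIn B) w → All B (nodes w)
    nodes-in {w = ε} a∈B b∈B i = a∈B ∷ []
    nodes-in {w = e ◅ ε} a∈B b∈B i = a∈B ∷ b∈B ∷ []
    nodes-in {w = e ◅ f ◅ w} a∈B b∈B i = a∈B ∷ nodes-in (middle-in {e = e} {f} a∈B b∈B i) b∈B (uncons (f ◅ w) i)

  between-closed : ∀ {c d a b} → a ⟶ b → b ∈ Between c d → a ∈ Between c d
  between-closed s = [ inj₁ ∘ anc-step s , inj₂ ∘ anc-step s ]′

  -- If the walk starts with a directed edge from `a` to `x`, following it gives `x ≼ a` or `x ≼ b`.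
  -- The latter would give `a ≼ b`, and so would a return from `x` through `S`; hence `x` returns to
  -- `a` itself.
  arrow⇒safe-left : ∀ {a b} {w : Walk G a b} → Interior (CollidersIn (Between a b)) w →
                    ¬ a ≼ b → AtFirst SafeAtLeft w
  arrow⇒safe-left {w = ε} i a⋠b = tt
  arrow⇒safe-left {w = link m m′ s ◅ w} i a⋠b (refl , refl)
    with Following.first-out _ between-closed (inj₂ ≼-refl) i refl
  ... | inj₂ x≼b = contradiction (anc-step s x≼b) a⋠b
  ... | inj₁ x≼a with ≼-back⇒Sc s x≼a
  ...   | inj₁ sc = sc
  ...   | inj₂ p  = contradiction (selected⇒≼ p) a⋠b

  arrow⇒safe-right : ∀ {a b} {w : Walk G a b} → Interior (CollidersIn (Between a b)) w →
                     ¬ b ≼ a → AtLast SafeAtRight w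
  arrow⇒safe-right {w = ε} i b⋠a = tt
  arrow⇒safe-right {a} {b} {w = f ◅ w} i b⋠a =
    atLast-map safe (f ◅ w) (Following.last-out _ between-closed (λ _ → inj₁ ≼-refl) i)
    where
    safe : ∀ {u} (e : Link G u b) → (markʳ e ≡ tail → u ∈ Between a b) → SafeAtRight e
    safe (link _ _ s) h (refl , refl) with h refl
    ... | inj₁ u≼a = contradiction (anc-step (flip s) u≼a) b⋠a
    ... | inj₂ u≼b with ≼-back⇒Sc (flip s) u≼b
    ...   | inj₁ sc = sc
    ...   | inj₂ p  = contradiction (selected⇒≼ p) b⋠a

  -- With all colliders in `Anc G S`, following the walk gives `x ≼ b`. Then `b ≼ a` would return
  -- `x` to `a`, which outside the component of `a` is possible only through `S`.
  unsafe⇒≺-left : ∀ {a x b} {f : Link G a x} {w : Walk G x b} →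
                  Interior (CollidersIn (Anc G S)) (f ◅ w) → ¬ SafeAtLeft f → a ≺ b
  unsafe⇒≺-left {f = link arrow _ s} i unsafe = ⊥-elim (unsafe λ { (() , _) })
  unsafe⇒≺-left {f = link tail tail s} i unsafe = ⊥-elim (noUndirected s)
  unsafe⇒≺-left {f = link tail arrow s} i unsafe
    with Following.first-out _ anc-step ≼-refl (interior-map (selected⇒≼ ∘_) i) refl
  ... | x≼b = anc-step s x≼b , λ b≼a → [ (λ sc → ⊥-elim (unsafe λ _ → sc)) , id ]′
                                        (≼-back⇒Sc s (≼-trans x≼b b≼a))

  unsafe⇒≺-right : ∀ {n x b} {f : Link G n x} {w : Walk G x b} →
                   Interior (CollidersIn (Anc G S)) (f ◅ w) →
                   AtLast (λ e → ¬ SafeAtRight e) (f ◅ w) → b ≺ n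
  unsafe⇒≺-right {a} {b = b} {f = f} {w} i unsafe =
    atLast-elim strict w
      (Following.last-out (_≼ a) anc-step (λ _ → ≼-refl) (interior-map (selected⇒≼ ∘_) i)) unsafe
    where
    strict : ∀ {u} (e : Link G u b) → (markʳ e ≡ tail → u ≼ a) → ¬ SafeAtRight e → b ≺ a
    strict (link _ arrow s) h unsafe = ⊥-elim (unsafe λ { (() , _) })
    strict (link tail tail s) h unsafe = ⊥-elim (noUndirected s)
    strict (link arrow tail s) h unsafe =
      anc-step (flip s) (h refl) , λ a≼b →
        [ (λ sc → ⊥-elim (unsafe λ _ → sc)) , id ]′ (≼-back⇒Sc (flip s) (≼-trans (h refl) a≼b))

  -- Cutting loops out of walks.

  suffix-from : ∀ {B : Subset N} {n a b} (w : Walk G a b) → n List.∈ nodes w →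
                Interior (OutgoingInSc G) w → AtFirst SafeAtLeft w → All B (nodes w) → IsPath w →
                ∃ λ (w′ : Walk G n b) → Interior (OutgoingInSc G) w′ × AtFirst SafeAtLeft w′ ×
                                        All B (nodes w′) × IsPath w′
  suffix-from ε       (here refl) i l m p = ε , i , l , m , p
  suffix-from (e ◅ w) (here refl) i l m p = e ◅ w , i , l , m , p
  suffix-from (e ◅ ε) (there n∈) i l (_ ∷ m) (_ ∷ p) = suffix-from ε n∈ ε tt m p
  suffix-from (e ◅ f ◅ w) (there n∈) (o ∷ i) l (_ ∷ m) (_ ∷ p) =
    suffix-from (f ◅ w) n∈ i (proj₂ o) m p

  -- Cutting out a loop keeps half-edges at a node that was interior on both sides of the cut.
  to-path : ∀ {B : Subset N} {a b} (w : Walk G a b) → Interior (OutgoingInSc G) w → All B (nodes w) →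
            ¬ ¬ ∃ λ (w′ : Walk G a b) → Interior (OutgoingInSc G) w′ ×
                                        (AtFirst SafeAtLeft w → AtFirst SafeAtLeft w′) ×
                                        All B (nodes w′) × IsPath w′
  to-path ε i m = pure (ε , i , id , m , [] ∷ [])
  to-path {a = a} {b} (e ◅ ε) i (a∈B ∷ b∈B ∷ []) = do
    no a≢b ← ¬¬-excluded-middle {A = a ≡ b}
      where yes refl → pure (ε , ε , (λ _ → tt) , b∈B ∷ [] , [] ∷ [])
    pure (e ◅ ε , [-] , id , a∈B ∷ b∈B ∷ [] , (a≢b ∷ []) ∷ [] ∷ [])
  to-path {a = a} (e ◅ f ◅ w) (o ∷ i) (a∈B ∷ m) = do
    (w′ , i′ , l , m′ , p) ← to-path (f ◅ w) i m
    yes a∈w′ ← ¬¬-excluded-middle {A = a List.∈ nodes w′}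
      where no a∉w′ → pure (e ◅ w′ , cons w′ (atFirst-map (λ _ s → proj₁ o , s) w′ (l (proj₂ o))) i′ ,
                            id , a∈B ∷ m′ , ¬Any⇒All¬ _ a∉w′ ∷ p)
    let (w″ , i″ , l″ , m″ , p″) = suffix-from w′ a∈w′ i′ (l (proj₂ o)) m′ p
    pure (w″ , i″ , (λ _ → l″) , m″ , p″)

  -- Segments, the pieces of a walk that become edges of `H`.

  data Flag : Set where
    safe strict : Flag

  -- `safe` constrains the end half-edge, `strict` only the endpoints: this is what an unsafe
  -- half-edge amounts to once the segment is complete.
  LeftEnd RightEnd : Flag → ∀ {a b} → Walk G a b → Set
  LeftEnd  safe           w = AtFirst SafeAtLeft w
  LeftEnd  strict {a} {b} w = a ≺ b
  RightEnd safe           w = AtLast SafeAtRight w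
  RightEnd strict {a} {b} w = b ≺ a

  -- `between` speaks of all nodes because joining segments and cutting out loops can turn
  -- non-colliders into colliders.
  record Segment (α β : Flag) (a b : N) : Set where
    field
      walk        : Walk G a b
      unblockable : Interior (OutgoingInSc G) walk
      between     : All (Between a b) (nodes walk)
      left        : LeftEnd α walk
      right       : RightEnd β walk

  join : ∀ {α β a b v} → Segment α safe a v → Segment safe β v b → Between a b v → Segment α β a b
  join {α} {β} {a} {b} {v} s t v∈ = record
    { walk        = walk s ◅◅ walk t
    ; unblockable = interior-◅◅ (walk s) (unblockable s) (unblockable t)
        (atLast-map (λ _ p → atFirst-map (λ _ q → p , q) (walk t) (left t)) (walk s) (right s))
    ; between     = nodes-◅◅ (walk s) (walk t)
        (All.map [ inj₁ , through ]′ (between s)) (All.map [ through , inj₂ ]′ (between t))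
    ; left        = joinˡ α (left s) (left t)
    ; right       = joinʳ β (right s) (right t)
    }
    where
    open Segment
    through : ∀ {n} → n ≼ v → Between a b n
    through p = [ inj₁ ∘ ≼-trans p , inj₂ ∘ ≼-trans p ]′ v∈
    joinˡ : ∀ α → LeftEnd α (walk s) → LeftEnd safe (walk t) → LeftEnd α (walk s ◅◅ walk t)
    joinˡ safe   p q = atFirst-◅◅ (walk s) p q
    -- If `v ≼ a`, strictness against `v` puts `a` into `Anc G S`, and then `a` is strict against
    -- every node.
    joinˡ strict p q = [ selected⇒≺ ∘ proj₂ p , ≺-≼-trans p ]′ v∈
    joinʳ : ∀ β → RightEnd safe (walk s) → RightEnd β (walk t) → RightEnd β (walk s ◅◅ walk t)
    joinʳ safe   p q = atLast-◅◅ (walk s) (walk t) p q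
    joinʳ strict p q = [ ≺-≼-trans q , selected⇒≺ ∘ proj₂ q ]′ v∈

  segment⇒σ-inducing : ∀ {α β a b} → Segment α β a b →
                       ¬ ¬ ∃ λ (w : Walk G a b) → SigmaInducingPath G S w
  segment⇒σ-inducing {a = a} {b} s = do
    (w , i , _ , m , p) ← to-path walk unblockable between
    pure (w , record
      { isPath      = p
      ; colliders   = λ { (collider c _) → widen (All.lookup m (consecutive-∈ c)) }
      ; unblockable = λ c _ → lookup i c
      })
    where
    open Segment s
    widen : Between a b ⊆ Anc G (｛ a ｝ ∪ ｛ b ｝ ∪ S)
    widen (inj₁ (c , inj₁ p , d)) = c , inj₁ p , d
    widen (inj₁ (c , inj₂ p , d)) = c , inj₂ (inj₂ p) , d
    widen (inj₂ (c , inj₁ p , d)) = c , inj₂ (inj₁ p) , d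
    widen (inj₂ (c , inj₂ p , d)) = c , inj₂ (inj₂ p) , d

-- Marks and local openness in `H`.

module Representation {V S : Set} (G : MixedGraph (V ⊎ S)) (dmg : IsDMG G)
                      (H : MixedGraph V) (represents : Represents H G) (Z : Subset V) where
  open SelectedDMG G dmg selected
  open Represents represents
  open MixedGraph
  W : Subset (V ⊎ S)
  W = observed Z ∪ selected

  open Opening G W

  tail⇒≼ : ∀ {a b m} → Edge H a tail m b → inj₁ a ≼ inj₁ b
  tail⇒≼ {m = tail}  s = tailmark (inj₂ s)
  tail⇒≼ {m = arrow} s = tailmark (inj₁ s)

  arrow⇒⋠ : ∀ {a b m} → Edge H a arrow m b → ¬ inj₁ a ≼ inj₁ b
  arrow⇒⋠ {m = tail}  s = arrowhead (inj₁ (flip H s))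
  arrow⇒⋠ {m = arrow} s = arrowhead (inj₂ (flip H s))

  record LocallyMOpen {u v x} (e : Link H u v) (f : Link H v x) : Set where
    constructor locally-m-open
    field
      colliders    : Collides H e f → v ∈ Anc H Z
      nonColliders : ¬ Collides H e f → v ∉ Z
      noIntoLine   : ¬ (markʳ e ≡ arrow × markˡ f ≡ tail × markʳ f ≡ tail)
      noLineInto   : ¬ (markˡ e ≡ tail × markʳ e ≡ tail × markˡ f ≡ arrow)

  open LocallyMOpen

  MOpen⇒locally : ∀ {x y} {w : Walk H x y} → MOpen H Z w → Interior LocallyMOpen w
  MOpen⇒locally {w = w} o = tabulate w λ c → locally-m-open
    (λ col → MOpen.colliders o (collider c col)) (λ ¬col → MOpen.nonColliders o (interior c ¬col))
    (MOpen.noIntoLine o c) (MOpen.noLineInto o c)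

  locally⇒MOpen : ∀ {x y} {w : Walk H x y} → x ∉ Z → y ∉ Z → Interior LocallyMOpen w → MOpen H Z w
  locally⇒MOpen x∉ y∉ i = record
    { nonColliders = λ { first → x∉ ; last → y∉ ; (interior c ¬col) → nonColliders (lookup i c) ¬col }
    ; colliders    = λ { (collider c col) → colliders (lookup i c) col }
    ; noIntoLine   = λ c → noIntoLine (lookup i c)
    ; noLineInto   = λ c → noLineInto (lookup i c)
    }

  locally⇒SigmaOpen : ∀ {a b} {w : Walk G a b} → a ∉ W → b ∉ W →
                      Interior (LocallyOpen (Anc G W)) w → SigmaOpen G W w
  locally⇒SigmaOpen a∉ b∉ i = record
    { colliders    = λ { (collider c col) → proj₁ (lookup i c) col }
    ; nonColliders = λ { first → a∉ ; last → b∉ ; (interior c _ ¬out) ∈W → ¬out (proj₂ (lookup i c) ∈W) }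
    }

  -- An edge of `H` only gives `≼`, so the walk found in `G` may end in the selected nodes instead
  -- of `Z`; `W` contains both.
  ancᴴ⇒ancᴳ : ∀ {v} → v ∈ Anc H Z → inj₁ v ∈ Anc G W
  ancᴴ⇒ancᴳ (z , z∈Z , ε)     = inj₁ z , inj₁ z∈Z , ε
  ancᴴ⇒ancᴳ (z , z∈Z , s ◅ d) = ≼-anc inj₂ (tail⇒≼ s) (ancᴴ⇒ancᴳ (z , z∈Z , d))

  -- From open walks in `H` to open walks in `G`.

  module FromH {x y : V} where

    A : Subset (V ⊎ S)
    A = AncestorOfEnds {inj₁ x} {inj₁ y}

    ≼-A : ∀ {a b} → a ≼ b → b ∈ A → a ∈ A
    ≼-A p b∈A with ≼-split p
    ... | inj₂ (c , c∈S , d) = inj₁ (c , inj₂ c∈S , d)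
    ... | inj₁ d with b∈A
    ...   | inj₁ q        = inj₁ (anc-walk d q)
    ...   | inj₂ (inj₁ q) = inj₂ (inj₁ (d ◅◅ q))
    ...   | inj₂ (inj₂ q) = inj₂ (inj₂ (d ◅◅ q))

    y∈A : inj₁ y ∈ A
    y∈A = inj₂ (inj₂ ε)

    -- Tails are followed to the right until `y` or a collider, an ancestor of `Z`, is reached. Only
    -- an undirected edge meeting an arrowhead could stop this, and openness forbids it.
    first-tail : ∀ {n m} {f : Link H n m} {w : Walk H m y} →
                 Interior LocallyMOpen (f ◅ w) → markˡ f ≡ tail → inj₁ n ∈ A
    first-tail {f = link tail _ s} {ε} i refl = ≼-A (tail⇒≼ s) y∈A
    first-tail {f = link tail _ s} {link tail _ t ◅ w} (l ∷ i) refl = ≼-A (tail⇒≼ s) (first-tail i refl)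
    first-tail {f = link tail arrow s} {link arrow _ t ◅ w} (l ∷ i) refl =
      ≼-A (tail⇒≼ s) (inj₁ (ancᴴ⇒ancᴳ (colliders l (refl , refl))))
    first-tail {f = link tail tail s} {link arrow _ t ◅ w} (l ∷ i) refl =
      contradiction (refl , refl , refl) (noLineInto l)

    middle : ∀ {n m k} {f : Link H n m} {g : Link H m k} {w : Walk H k y} → inj₁ n ∈ A →
             Interior LocallyMOpen (f ◅ g ◅ w) → inj₁ m ∈ A
    middle {g = link tail _ t} n∈A (l ∷ i) = first-tail i refl
    middle {f = link _ tail s} {link arrow _ t} n∈A i = ≼-A (tail⇒≼ (flip H s)) n∈A
    middle {f = link _ arrow s} {link arrow _ t} n∈A (l ∷ i) = inj₁ (ancᴴ⇒ancᴳ (colliders l (refl , refl)))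

    edge-distinct : ∀ {a b} → Link H a b → a ≢ b
    edge-distinct (link _ _ s) refl = Simple.loopless simple (_ , _ , s)

    edge⇒walk : ∀ {a b} (f : Link H a b) → inj₁ a ∈ A → inj₁ b ∈ A →
                ∃ λ (w : Walk G (inj₁ a) (inj₁ b)) →
                  Interior (LocallyOpen A) w ×
                  (markˡ f ≡ arrow → AtFirst SafeAtLeft w) ×
                  (markʳ f ≡ arrow → AtLast SafeAtRight w)
    edge⇒walk {a} {b} f a∈A b∈A
      with Equivalence.to (adjacency (edge-distinct f)) (_ , _ , edge f)
    ... | w , p = w
                , tabulate w (λ c → (λ col → through (between (SigmaInducingPath.colliders p (collider c col))))
                                  , λ _ → outgoing c)
                , (λ { refl → arrow⇒safe-left i (arrow⇒⋠ (edge f)) })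
                , (λ { refl → arrow⇒safe-right i (arrow⇒⋠ (flip H (edge f))) })
      where
      between : Anc G (｛ inj₁ a ｝ ∪ ｛ inj₁ b ｝ ∪ selected) ⊆ Between (inj₁ a) (inj₁ b)
      between (c , inj₁ p , d)        = inj₁ (c , inj₁ p , d)
      between (c , inj₂ (inj₁ p) , d) = inj₂ (c , inj₁ p , d)
      between (c , inj₂ (inj₂ p) , d) = inj₁ (c , inj₂ p , d)
      outgoing : ∀ {u v x} {e : Link G u v} {g : Link G v x} → Consecutive w e g → OutgoingInSc G e g
      outgoing {e = e} {g} c with collides? e g
      ... | yes (refl , refl) = (λ { (() , _) }) , λ { (() , _) }
      ... | no ¬col           = SigmaInducingPath.unblockable p c ¬col
      i : Interior (CollidersIn (Between (inj₁ a) (inj₁ b))) w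
      i = tabulate w λ c col → between (SigmaInducingPath.colliders p (collider c col))
      through : Between (inj₁ a) (inj₁ b) ⊆ A
      through = [ (λ q → ≼-A q a∈A) , (λ q → ≼-A q b∈A) ]′

    lift : ∀ {n} (w : Walk H n y) → inj₁ n ∈ A → Interior LocallyMOpen w →
           ∃ λ (w′ : Walk G (inj₁ n) (inj₁ y)) →
             Interior (LocallyOpen A) w′ ×
             (AtFirst (λ f → markˡ f ≡ arrow) w → AtFirst SafeAtLeft w′)
    lift ε       n∈A i = ε , ε , λ _ → tt
    lift (f ◅ ε) n∈A i =
      let (w , o , l , _) = edge⇒walk f n∈A y∈A in w , o , l
    lift {n} (_◅_ {j = m} f (g ◅ w)) n∈A (p ∷ i) =
      let m∈A             = middle n∈A (p ∷ i)
          (w₁ , o₁ , l₁ , r₁) = edge⇒walk f n∈A m∈A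
          (w₂ , o₂ , l₂)      = lift (g ◅ w) m∈A i
      in w₁ ◅◅ w₂
       , interior-◅◅ w₁ o₁ o₂ (junction m∈A w₁ w₂ r₁ l₂)
       , λ q → atFirst-◅◅-≢ (λ { refl → edge-distinct f refl }) w₁ (l₁ q)
      where
      junction : inj₁ m ∈ A → ∀ {a b} (w₁ : Walk G a (inj₁ m)) (w₂ : Walk G (inj₁ m) b) →
                 (markʳ f ≡ arrow → AtLast SafeAtRight w₁) → (markˡ g ≡ arrow → AtFirst SafeAtLeft w₂) →
                 AtLast (λ e → AtFirst (LocallyOpen A e) w₂) w₁
      junction m∈A w₁ w₂ r l with collides? f g
      -- At a collider of `H` both half-edges in `G` are safe, so `m` cannot block even if it is in
      -- `Z`; at a non-collider `m` is outside `Z`. In either case `m` may collide in `G`, being in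
      -- `A`.
      ... | yes (f→ , g→) = atLast-map
              (λ _ s → atFirst-map (λ _ t → (λ _ → m∈A) , λ _ → s , t) w₂ (l g→)) w₁ (r f→)
      ... | no ¬col = atLast-tabulate (λ _ → atFirst-tabulate (λ _ → (λ _ → m∈A) ,
              λ { (inj₁ m∈Z) → contradiction m∈Z (nonColliders p ¬col) }) w₂) w₁

    open-walk : x ∉ Z → y ∉ Z → (w : Walk H x y) → MOpen H Z w →
                ¬ ¬ ∃ λ (w′ : Walk G (inj₁ x) (inj₁ y)) → SigmaOpen G W w′
    open-walk x∉ y∉ w o =
      let (w′ , i , _) = lift w (inj₂ (inj₁ ε)) (MOpen⇒locally o)
      in ¬¬-map (λ (w″ , j) → w″ , locally⇒SigmaOpen [ x∉ , (λ ()) ]′ [ y∉ , (λ ()) ]′ j) (make-open w′ i)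

  -- From chains of segments to open walks in `H`.

  module ToH {y : V} where

    -- The two kinds of cut: at a blockable non-collider one side is unsafe, which becomes `strict`;
    -- at a collider in `Z` both half-edges are arrowheads, hence `safe`, and `join` can undo the
    -- cut.
    Junction : Flag → V → Flag → Set
    Junction β v γ = (v ∉ Z × (β ≡ strict ⊎ γ ≡ strict)) ⊎ (v ∈ Z × β ≡ safe × γ ≡ safe)

    -- In Chain a α n, the first segment has the flag α at a and ends at n.  Junctions in Z are
    -- not below their neighbours, which makes them colliders in H.
    data Chain : V → Flag → V → Set where
      [_]    : ∀ {a α β} → Segment α β (inj₁ a) (inj₁ y) → Chain a α y
      extend : ∀ {a α β v γ n} → Segment α β (inj₁ a) (inj₁ v) → Junction β v γ →
               (v ∈ Z → ¬ Between (inj₁ a) (inj₁ n) (inj₁ v)) → Chain v γ n → Chain a α v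

    -- After a merge the next junction has a new left neighbour, so its old evidence is dropped and
    -- the test repeated on a shorter chain. `join` keeps the outer flags, so that junction keeps
    -- its kind.
    prepend-segment : ∀ {a α β v γ n} → Segment α β (inj₁ a) (inj₁ v) → Junction β v γ →
                      Chain v γ n → ¬ ¬ ∃ λ m → Chain a α m
    prepend-segment s j@(inj₁ (v∉Z , _)) t = pure (_ , extend s j (λ v∈Z → contradiction v∈Z v∉Z) t)
    prepend-segment {a} {v = v} {n = n} s j@(inj₂ (_ , refl , refl)) t = do
      yes b ← ¬¬-excluded-middle {A = Between (inj₁ a) (inj₁ n) (inj₁ v)}
        where no ¬b → pure (_ , extend s j (λ _ → ¬b) t)
      merge b t
      where
      merge : ∀ {n} → Between (inj₁ a) (inj₁ n) (inj₁ v) → Chain v safe n → ¬ ¬ ∃ λ m → Chain a _ m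
      merge b [ t ]             = pure (_ , [ join s t b ])
      merge b (extend t j _ t′) = prepend-segment (join s t b) j t′

    -- As `v ≼ u`, the edge `e` has a tail at `v`. If `e` is undirected, `u ≼ v` holds too and
    -- strictness puts `v` into `Anc G selected`; then `v ≼ x`, so `f` has no arrowhead at `v`.
    ≺⇒m-open-left : ∀ {u v x} (e : Link H u v) (f : Link H v x) → v ∉ Z →
                    inj₁ v ≺ inj₁ u → LocallyMOpen e f
    ≺⇒m-open-left (link _ arrow s) f v∉Z (v≼u , _) = contradiction v≼u (arrow⇒⋠ (flip H s))
    ≺⇒m-open-left (link m tail s) f v∉Z (_ , str) = locally-m-open
      (λ { (() , _) }) (λ _ → v∉Z) (λ { (() , _) })
      λ { (refl , _ , refl) → arrow⇒⋠ (edge f) (selected⇒≼ (str (tail⇒≼ s))) }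

    ≺⇒m-open-right : ∀ {u v x} (e : Link H u v) (f : Link H v x) → v ∉ Z →
                     inj₁ v ≺ inj₁ x → LocallyMOpen e f
    ≺⇒m-open-right e (link arrow _ t) v∉Z (v≼x , _) = contradiction v≼x (arrow⇒⋠ t)
    ≺⇒m-open-right e (link tail m t) v∉Z (_ , str) = locally-m-open
      (λ { (_ , ()) }) (λ _ → v∉Z)
      (λ { (refl , _ , refl) → arrow⇒⋠ (flip H (edge e)) (selected⇒≼ (str (tail⇒≼ (flip H t)))) })
      λ { (_ , _ , ()) }

    ⋠⇒m-open : ∀ {u v x} (e : Link H u v) (f : Link H v x) → v ∈ Z →
               ¬ inj₁ v ≼ inj₁ u → ¬ inj₁ v ≼ inj₁ x → LocallyMOpen e f
    ⋠⇒m-open (link _ tail s)  f               v∈Z v⋠u v⋠x = contradiction (tail⇒≼ (flip H s)) v⋠u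
    ⋠⇒m-open (link _ arrow s) (link tail _ t) v∈Z v⋠u v⋠x = contradiction (tail⇒≼ t) v⋠x
    ⋠⇒m-open (link _ arrow s) (link arrow _ t) v∈Z v⋠u v⋠x = locally-m-open
      (λ _ → _ , v∈Z , ε) (λ ¬col → contradiction (refl , refl) ¬col) (λ { (_ , () , _) }) λ { (_ , () , _) }

    segment⇒edge : ∀ {a b α β} → a ≢ b → Segment α β (inj₁ a) (inj₁ b) → ¬ ¬ Link H a b
    segment⇒edge a≢b s =
      ¬¬-map (λ p → let (_ , _ , e) = Equivalence.from (adjacency a≢b) p in link _ _ e)
             (segment⇒σ-inducing s)

    -- Segments from a node to itself are dropped.
    chain⇒walk : ∀ {a α n} → Chain a α n →
                 ¬ ¬ ∃ λ (w : Walk H a y) → Interior LocallyMOpen w ×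
                       (α ≡ strict → AtFirst (λ {x} _ → inj₁ a ≺ inj₁ x) w) ×
                       (¬ inj₁ a ≼ inj₁ n → AtFirst (λ {x} _ → ¬ inj₁ a ≼ inj₁ x) w)
    chain⇒walk {a} [ s ] = do
      no a≢y ← ¬¬-excluded-middle {A = a ≡ y}
        where yes refl → pure (ε , ε , (λ _ → tt) , λ _ → tt)
      e ← segment⇒edge a≢y s
      pure (e ◅ ε , [-] , (λ { refl → Segment.left s }) , id)
    chain⇒walk {a} (extend {v = v} s j peak t) = do
      (w , i , str , top) ← chain⇒walk t
      no a≢v ← ¬¬-excluded-middle {A = a ≡ v}
        where
          -- A strict segment from `a` to itself puts `a` into `Anc G selected`, so `a` is strict
          -- against whatever node comes next on `w`.
          yes refl → pure (w , i
            , (λ { refl → atFirst-tabulate (λ _ → selected⇒≺ (≺-irrefl (Segment.left s))) w })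
            , λ a⋠a → contradiction ≼-refl a⋠a)
      e ← segment⇒edge a≢v s
      pure (e ◅ w , cons w (junction e w str top j) i , (λ { refl → Segment.left s }) , id)
      where
      junction : ∀ {γ} (e : Link H a v) (w : Walk H v y) →
                 (γ ≡ strict → AtFirst (λ {x} _ → inj₁ v ≺ inj₁ x) w) →
                 (¬ inj₁ v ≼ _ → AtFirst (λ {x} _ → ¬ inj₁ v ≼ inj₁ x) w) →
                 Junction _ v γ → AtFirst (LocallyMOpen e) w
      junction e w str top (inj₁ (v∉Z , inj₁ refl)) =
        atFirst-tabulate (λ f → ≺⇒m-open-left e f v∉Z (Segment.right s)) w
      junction e w str top (inj₁ (v∉Z , inj₂ refl)) =
        atFirst-map (λ f → ≺⇒m-open-right e f v∉Z) w (str refl)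
      junction e w str top (inj₂ (v∈Z , _)) =
        atFirst-map (λ f → ⋠⇒m-open e f v∈Z (peak v∈Z ∘ inj₁)) w (top (peak v∈Z ∘ inj₂))

    -- Cutting an open walk in `G` into a chain, from right to left.

    Rest : Flag → V → Set
    Rest β v = v ≡ y ⊎ ∃₂ λ γ n → Junction β v γ × Chain v γ n

    -- The left endpoint of a growing segment is still unknown, so `strict` is recorded as an unsafe
    -- half-edge until `close` turns it into `≺`.
    LeftHalf : Flag → ∀ {v x} → Link G v x → Set
    LeftHalf safe   f = SafeAtLeft f
    LeftHalf strict f = ¬ SafeAtLeft f

    RightHalf : Flag → ∀ {u v} → Link G u v → Set
    RightHalf safe   e = SafeAtRight e
    RightHalf strict e = ¬ SafeAtRight e

    -- Colliders outside `Anc G selected` are cut or replaced by excursions; the remaining ones let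
    -- unsafe ends become strict.
    Inner : ∀ {u v x} → Link G u v → Link G v x → Set
    Inner e f = OutgoingInSc G e f × CollidersIn (Anc G selected) e f

    -- The segment f ◅ walk may still grow to the left; rest is final.
    record Remainder {n x} (f : Link G n x) : Set where
      field
        {flag}  : Flag
        {end}   : V
        walk    : Walk G x (inj₁ end)
        inner   : Interior Inner (f ◅ walk)
        half    : AtLast (RightHalf flag) (f ◅ walk)
        rest    : Rest flag end

    close : ∀ {α v x} {f : Link G (inj₁ v) x} → LeftHalf α f → Remainder f → ¬ ¬ ∃ λ n → Chain v α n
    close {α} {v} {f = f} l r = attach (Remainder.rest r)
      where
      open Remainder r
      colliders-in : Interior (CollidersIn (Anc G selected)) (f ◅ walk)
      colliders-in = interior-map proj₂ inner
      leftEnd : ∀ α → LeftHalf α f → LeftEnd α (f ◅ walk)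
      leftEnd safe   l = l
      leftEnd strict l = unsafe⇒≺-left colliders-in l
      rightEnd : ∀ β → AtLast (RightHalf β) (f ◅ walk) → RightEnd β (f ◅ walk)
      rightEnd safe   h = h
      rightEnd strict h = unsafe⇒≺-right colliders-in h
      segment : Segment α flag (inj₁ v) (inj₁ end)
      segment = record
        { walk        = f ◅ walk
        ; unblockable = interior-map proj₁ inner
        ; between     = Following.nodes-in _ between-closed (inj₁ ≼-refl) (inj₂ ≼-refl)
                          (interior-map ((inj₁ ∘ selected⇒≼) ∘_) colliders-in)
        ; left        = leftEnd α l
        ; right       = rightEnd flag half
        }
      attach : Rest flag end → ¬ ¬ ∃ λ n → Chain v α n
      attach (inj₁ refl)            = pure (_ , [ segment ])
      attach (inj₂ (_ , _ , j , t)) = prepend-segment segment j t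

    grow : ∀ {u v x} {e : Link G u v} {f : Link G v x} → Inner e f → Remainder f → Remainder e
    grow {f = f} o r = record { walk = f ◅ walk ; inner = o ∷ inner ; half = half ; rest = rest }
      where open Remainder r

    split : ∀ {α β u v x} {e : Link G u (inj₁ v)} {f : Link G (inj₁ v) x} →
            RightHalf β e → LeftHalf α f → Junction β v α → Remainder f → ¬ ¬ Remainder e
    split h l j r = ¬¬-map
      (λ (n , t) → record { walk = ε ; inner = [-] ; half = h ; rest = inj₂ (_ , n , j , t) }) (close l r)

    leftHalf : ∀ {v x} (f : Link G v x) → ¬ ¬ ∃ λ α → LeftHalf α f
    leftHalf f = ¬¬-map (λ { (yes p) → safe , p ; (no ¬p) → strict , ¬p }) ¬¬-excluded-middle

    rightHalf : ∀ {u v} (e : Link G u v) → ¬ ¬ ∃ λ β → RightHalf β e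
    rightHalf e = ¬¬-map (λ { (yes p) → safe , p ; (no ¬p) → strict , ¬p }) ¬¬-excluded-middle

    pass-nonCollider : ∀ {u v x} (e : Link G u v) (f : Link G v x) → ¬ Collides G e f →
                       (v ∈ W → ¬ ¬ OutgoingInSc G e f) → Remainder f → ¬ ¬ Remainder e
    pass-nonCollider {v = v} e f ¬col open-at r = do
      no ¬out ← ¬¬-excluded-middle {A = OutgoingInSc G e f}
        where yes out → pure (grow (out , λ col → contradiction col ¬col) r)
      (β , h) ← rightHalf e
      (α , l) ← leftHalf f
      split-blockable v β α h l ¬out (λ ∈W → open-at ∈W ¬out) r
      where
      -- Outside `W` the node is observed, as a cut requires; two safe halves would amount to
      -- `OutgoingInSc`.
      split-blockable : ∀ v {u x} {e : Link G u v} {f : Link G v x} β α → RightHalf β e → LeftHalf α f →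
                        ¬ OutgoingInSc G e f → v ∉ W → Remainder f → ¬ ¬ Remainder e
      split-blockable (inj₂ _) β      α      h l ¬out v∉W = contradiction (inj₂ _) v∉W
      split-blockable (inj₁ _) safe   safe   h l ¬out v∉W = contradiction (h , l) ¬out
      split-blockable (inj₁ _) strict α      h l ¬out v∉W = split {α = α} h l (inj₁ (v∉W ∘ inj₁ , inj₁ refl))
      split-blockable (inj₁ _) safe   strict h l ¬out v∉W = split {β = safe} h l (inj₁ (v∉W ∘ inj₁ , inj₂ refl))

    -- A collider outside Z is replaced by an excursion along a directed walk to Z and back.
    excursion : ∀ {u v x z} {e : Link G u v} {f : Link G v x} → Collides G e f →
                DirectedWalk G v z → z ∈ observed Z → v ∉ Anc G selected →
                Remainder f → ¬ ¬ Remainder e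
    excursion {v = inj₂ _} col d z∈Z v∉ r = contradiction (_ , _ , ε) v∉
    excursion {v = inj₁ v} {e = e} {f} (refl , refl) d z∈Z v∉ r = do
      no v∉Z ← ¬¬-excluded-middle {A = v ∈ Z}
        where yes v∈Z → split (λ { (() , _) }) (λ { (() , _) }) (inj₂ (v∈Z , refl , refl)) r
      go d z∈Z v∉Z
      where
      go : ∀ {z} → DirectedWalk G (inj₁ v) z → z ∈ observed Z → v ∉ Z → ¬ ¬ Remainder e
      go ε       z∈Z v∉Z = contradiction z∈Z v∉Z
      go (s ◅ d) z∈Z v∉Z = do
        -- Built from the right: first the return to `v` against `s`, then the collider moved one
        -- step along the directed walk, then the departure from `v`. Both visits to `v` are
        -- non-colliders outside `W`.
        r₁ ← pass-nonCollider (link arrow tail (flip G s)) f (λ { (() , _) }) v∉W r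
        r₂ ← excursion {e = link tail arrow s} (refl , refl) d z∈Z (v∉ ∘ anc-step s) r₁
        pass-nonCollider e (link tail arrow s) (λ { (_ , ()) }) v∉W r₂
        where
        v∉W : ∀ {A : Set} → inj₁ v ∈ W → A
        v∉W (inj₁ p) = contradiction p v∉Z

    pass : ∀ {u v x} (e : Link G u v) (f : Link G v x) → (Collides G e f → v ∈ Anc G W) →
           (v ∈ W → ¬ ¬ OutgoingInSc G e f) → Remainder f → ¬ ¬ Remainder e
    pass {v = v} e f open-collider open-at r with collides? e f
    ... | no ¬col                 = pass-nonCollider e f ¬col open-at r
    ... | yes (refl , refl) = do
      no v∉S ← ¬¬-excluded-middle {A = v ∈ Anc G selected}
        where yes v∈S → pure (grow (((λ { (() , _) }) , λ { (() , _) }) , λ _ → v∈S) r)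
      (z , inj₁ z∈Z , d) ← pure (open-collider (refl , refl))
        where (z , inj₂ z∈S , d) → contradiction (z , z∈S , d) v∉S
      excursion (refl , refl) d z∈Z v∉S r

    scan : ∀ {n x} (f : Link G n x) (w : Walk G x (inj₁ y)) →
           (∀ {u v x} {e : Link G u v} {g : Link G v x} → Consecutive (f ◅ w) e g →
              (Collides G e g → v ∈ Anc G W) × (v ∈ W → ¬ ¬ OutgoingInSc G e g)) →
           ¬ ¬ Remainder f
    scan f ε h = do
      (β , p) ← rightHalf f
      pure (record { walk = ε ; inner = [-] ; half = p ; rest = inj₁ refl })
    scan f (g ◅ w) h = do
      r ← scan g w (λ c → h (there c))
      pass f g (proj₁ (h here)) (proj₂ (h here)) r

    m-open-walk : ∀ {x} → x ∉ Z → y ∉ Z → (w : Walk G (inj₁ x) (inj₁ y)) → SigmaOpen G W w →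
                  ¬ ¬ ∃ λ (w′ : Walk H x y) → MOpen H Z w′
    m-open-walk x∉ y∉ ε       o = pure (ε , locally⇒MOpen x∉ y∉ ε)
    m-open-walk x∉ y∉ (f ◅ w) o = do
      r ← scan f w λ c → (λ col → SigmaOpen.colliders o (collider c col)) , blockable c
      (α , l) ← leftHalf f
      (_ , t) ← close l r
      (w′ , i , _) ← chain⇒walk t
      pure (w′ , locally⇒MOpen x∉ y∉ i)
      where
      -- Being blockable is itself a negation, and openness refutes it; hence the double negation.
      blockable : ∀ {u v x} {e : Link G u v} {g : Link G v x} → Consecutive (f ◅ w) e g →
                  v ∈ W → ¬ ¬ OutgoingInSc G e g
      blockable {e = e} {g} c v∈W ¬out with collides? e g
      ... | yes (refl , refl) = ¬out ((λ { (() , _) }) , λ { (() , _) })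
      ... | no ¬col           = SigmaOpen.nonColliders o (interior c ¬col ¬out) v∈W

theorem2 : {V S : Set} (G : MixedGraph (V ⊎ S)) → IsDMG G →
    (H : MixedGraph V) → IsSigmaMAG H → Represents H G →
    (X Y Z : Subset V) →
    MSeparated H X Y Z ⇔ SigmaSeparated G (observed X) (observed Y) (observed Z ∪ selected)
theorem2 G dmg H _ represents X Y Z = mk⇔ to from
  where
  open Representation G dmg H represents Z
  to : MSeparated H X Y Z → SigmaSeparated G (observed X) (observed Y) W
  to sep {inj₁ x} {inj₁ y} x∈X y∈Y w o =
    ToH.m-open-walk (SigmaOpen.nonColliders o first ∘ inj₁) (SigmaOpen.nonColliders o last ∘ inj₁) w o
      λ (w′ , o′) → sep x∈X y∈Y w′ o′
  from : SigmaSeparated G (observed X) (observed Y) W → MSeparated H X Y Z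
  from sep x∈X y∈Y w o =
    FromH.open-walk (MOpen.nonColliders o first) (MOpen.nonColliders o last) w o
      λ (w′ , o′) → sep {inj₁ _} {inj₁ _} x∈X y∈Y w′ o′
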